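{- Let $n\ge 2$ be an integer. For any $3$-coloring of the edges of the complete graph $K_n$ on $n$ vertices, there exist a color $c$ and a subset $A$ of at most four vertices of $K_n$ such that $A$ strongly $c$-dominates at least $2n/3$ vertices of $K_n$ (that is, $A$ strongly $c$-dominates some set $B$ of vertices of $K_n$ with $|B|\ge 2n/3$).
   Context: A $3$-coloring of the edges of $K_n$ is an arbitrary assignment of a color from $\{1,2,3\}$ to each edge (it need not be proper and need not use all three colors). Given such a coloring and a color $c$, a subset $A$ of the vertex set $c$-dominates a subset $B$ of the vertex set if for every $y\in B\setminus A$ there exists $x\in A$ such that the edge $xy$ is colored $c$. The subset $A$ strongly $c$-dominates $B$ if, in addition, for every $y\in B\cap A$ there exists $x\in A$ such that $xy$ is an edge (so $x\ne y$) colored $c$. Thus $A$ strongly $c$-dominates $B$ if and only if every vertex $y\in B$ is joined by an edge of color $c$ to some vertex of $A$. -}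

module Defs where

open import Data.Nat.Base using (ℕ)
open import Data.Fin.Base using (Fin)
open import Data.Fin.Subset using (Subset; _∈_; _∉_)
open import Data.Product.Base using (∃-syntax; _×_)
open import Relation.Binary.PropositionalEquality.Core using (_≡_; _≢_)

-- The vertices of Kₙ are the elements of Fin n and its edges are the
-- unordered pairs of distinct vertices.  The values colour x x are junk:
-- they are never inspected, because Joined requires x ≢ y.
record EdgeColouring (k n : ℕ) : Set where
  field
    colour     : Fin n → Fin n → Fin k
    colour-sym : ∀ x y → colour x y ≡ colour y x

module _ {k n : ℕ} (χ : EdgeColouring k n) (c : Fin k) where

  open EdgeColouring χ

  Joined : Fin n → Fin n → Set
  Joined x y = x ≢ y × colour x y ≡ c

  Dominates : Subset n → Subset n → Set
  Dominates A B = ∀ y → y ∈ B → y ∉ A → ∃[ x ] (x ∈ A × Joined x y)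

  StronglyDominates : Subset n → Subset n → Set
  StronglyDominates A B =
    Dominates A B ×
    (∀ y → y ∈ B → y ∈ A → ∃[ x ] (x ∈ A × Joined x y))

-- Suppose every set of at most four vertices leaves more than n/3 vertices
-- undominated in every colour.
--
-- Write W for the following weighted sum over 5-tuples of distinct vertices:
-- the first four vertices Q contribute, for each colour c, a weight depending
-- on the colouring of Q times 3[the fifth vertex is not c-joined to Q] − 1, and
-- each rainbow triangle T contributes four times Σ_c f_c(v) f_c(w) over the
-- other two vertices v, w, where f_c(v) = 3[v is not c-joined to T] − 1.  The
-- assumption bounds the first part from below, the second part is a sum of
-- squares up to its diagonal, and both bounds are sums over 4-tuples.  The
-- weights are a solution of a linear program: for every colouring of K₅ the
-- symmetrised W is at most 0, and for every colouring of K₄ the symmetrised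
-- lower bound is nonnegative, and positive if some vertex sees three colours.
-- Hence every vertex v misses a colour m(v).
--
-- If m(x) ≠ m(y) and c is the third colour, then xy has colour c and {x, y}
-- c-dominates every v with m(v) ≠ c, so more than n/3 vertices miss c.  Then
-- all three colours are missed, each by more than n/3 vertices, which is
-- absurd.  So m is constant and only two colours occur.  For a red edge xy let
-- D and E be the sets of vertices joined to both x and y in blue and in red.
-- The red set {x, y} shows |D| > n/3, the blue sets {x, y, d} show that each
-- d ∈ D has more than n/3 red neighbours in E, and the red sets {x, y, e} that
-- each e ∈ E has more than n/3 blue neighbours in D.  Hence
-- |D||E| > (|D| + |E|) n/3 ≥ (|D| + |E|)²/3, contradicting the inequality
-- between the arithmetic and the geometric mean.

module Submission where

open import Defs
open import Data.Nat.Base as ℕ using (ℕ)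
import Data.Nat.Properties as ℕ
open import Data.Fin.Base using (Fin)
open import Data.Fin.Subset using (Subset; ∣_∣)
open import Data.Product.Base using (Σ-syntax; _×_)

module Development where

  open import Algebra.Properties.Semiring.Sum as Sum using ()
  open import Data.Bool.Base using (Bool; true; false; _∧_; _∨_; not; if_then_else_)
  import Data.Bool.Properties as Bool
  open import Data.Empty using (⊥; ⊥-elim)
  open import Data.Fin.Base using (zero; suc)
  open import Data.Fin.Patterns using (0F; 1F; 2F)
  open import Data.Fin.Properties using (_≟_; any?)
  open import Data.Fin.Subset using (_∈_; _∪_; ⁅_⁆)
  open import Data.Fin.Subset.Properties using (x∈⁅x⁆; x∈p∪q⁺; ∣⁅x⁆∣≡1)
  open import Data.Integer.Base
    using (ℤ; +_; -[1+_]; -_; _+_; _*_; _-_; _≤_; _<_; _≤ᵇ_; 0ℤ; 1ℤ; -1ℤ; +≤+; -≤+; +<+; NonNegative; nonNegative; positive)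
  import Data.Integer.Properties as ℤ
  open import Data.Integer.Tactic.RingSolver using (solve-∀)
  open import Data.List.Base using (List; []; _∷_)
  open import Data.List.Relation.Unary.All using (All; []; _∷_)
  open import Data.Nat.Base using (zero; suc; z≤n; s≤s)
  open import Data.Product.Base using (∃-syntax; _,_; proj₁; proj₂)
  open import Data.Sum.Base using (_⊎_; inj₁; inj₂)
  open import Data.Unit.Base using (⊤; tt)
  open import Data.Vec.Base using (Vec; []; _∷_; _∷ʳ_; tabulate)
  open import Data.Vec.Properties using ([]=⇒lookup; lookup∘tabulate)
  open import Function.Base using (_∘_; case_of_)
  open import Function.Bundles using (Equivalence)
  open import Relation.Binary.PropositionalEquality
    using (_≡_; _≢_; refl; sym; trans; cong; cong₂; subst; subst₂; ≢-sym; module ≡-Reasoning)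
  open import Relation.Nullary.Decidable.Core using (Dec; yes; no; does)
  open import Relation.Nullary.Negation.Core using (¬_; contradiction)

  open Sum ℤ.+-*-semiring
    using (sum; sum-cong-≗; sum-replicate-zero; ∑-distrib-+; ∑-comm; *-distribˡ-sum; *-distribʳ-sum)

  -- Sums over tuples of distinct vertices

  ∑-mono : ∀ {n} {f g : Fin n → ℤ} → (∀ i → f i ≤ g i) → sum f ≤ sum g
  ∑-mono {zero}  f≤g = ℤ.≤-refl
  ∑-mono {suc n} f≤g = ℤ.+-mono-≤ (f≤g zero) (∑-mono (f≤g ∘ suc))

  module _ {n : ℕ} where

    distinct : Fin n → Fin n → ℤ
    distinct x y = if does (x ≟ y) then 0ℤ else 1ℤ

    distinct-sym : ∀ x y → distinct x y ≡ distinct y x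
    distinct-sym x y with x ≟ y | y ≟ x
    ... | yes _    | yes _    = refl
    ... | no _     | no _     = refl
    ... | yes refl | no y≢y   = contradiction refl y≢y
    ... | no x≢x   | yes refl = contradiction refl x≢x

    -- A 0/1 factor rather than a restricted index set: every sum still runs over all of `Fin n`, so
    -- sums can be interchanged freely.
    fresh : List (Fin n) → Fin n → ℤ
    fresh []      v = 1ℤ
    fresh (x ∷ L) v = distinct x v * fresh L v

    Fresh : List (Fin n) → Fin n → Set
    Fresh L v = All (_≢ v) L

    fresh-cases : ∀ L v → (Fresh L v × fresh L v ≡ 1ℤ) ⊎ fresh L v ≡ 0ℤ
    fresh-cases []      v = inj₁ ([] , refl)
    fresh-cases (x ∷ L) v with x ≟ v | fresh-cases L v
    ... | yes _  | _                 = inj₂ refl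
    ... | no x≢v | inj₁ (L≢v , eq)   = inj₁ (x≢v ∷ L≢v , trans (ℤ.*-identityˡ _) eq)
    ... | no x≢v | inj₂ eq           = inj₂ (trans (ℤ.*-identityˡ _) eq)

    Fresh⇒fresh≡1 : ∀ {L v} → Fresh L v → fresh L v ≡ 1ℤ
    Fresh⇒fresh≡1 []                    = refl
    Fresh⇒fresh≡1 {x ∷ L} {v} (x≢v ∷ p) with x ≟ v
    ... | yes x≡v = contradiction x≡v x≢v
    ... | no _    = trans (ℤ.*-identityˡ _) (Fresh⇒fresh≡1 p)

    ∑∉ : List (Fin n) → (Fin n → ℤ) → ℤ
    ∑∉ L f = sum λ v → fresh L v * f v

    ∑∉-mono : ∀ L {f g} → (∀ v → Fresh L v → f v ≤ g v) → ∑∉ L f ≤ ∑∉ L g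
    ∑∉-mono L {f} {g} f≤g = ∑-mono pointwise
      where
      pointwise : ∀ v → fresh L v * f v ≤ fresh L v * g v
      pointwise v with fresh-cases L v
      ... | inj₁ (p , eq) rewrite eq = ℤ.*-monoˡ-≤-nonNeg 1ℤ (f≤g v p)
      ... | inj₂ eq       rewrite eq = ℤ.≤-refl

    ∑∉-cong : ∀ L {f g} → (∀ v → Fresh L v → f v ≡ g v) → ∑∉ L f ≡ ∑∉ L g
    ∑∉-cong L f≡g = ℤ.≤-antisym (∑∉-mono L λ v p → ℤ.≤-reflexive (f≡g v p))
                                (∑∉-mono L λ v p → ℤ.≤-reflexive (sym (f≡g v p)))

    ∑∉-+ : ∀ L f g → ∑∉ L (λ v → f v + g v) ≡ ∑∉ L f + ∑∉ L g
    ∑∉-+ L f g = trans (sum-cong-≗ λ v → ℤ.*-distribˡ-+ (fresh L v) (f v) (g v))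
                       (∑-distrib-+ (λ v → fresh L v * f v) (λ v → fresh L v * g v))

    ∑∉-linear : ∀ {m} L (w : Fin m → ℤ) (f : Fin m → Fin n → ℤ) →
      ∑∉ L (λ v → sum λ k → w k * f k v) ≡ sum λ k → w k * ∑∉ L (f k)
    ∑∉-linear L w f = begin
      sum (λ v → fresh L v * sum λ k → w k * f k v)
        ≡⟨ sum-cong-≗ (λ v → *-distribˡ-sum (fresh L v) λ k → w k * f k v) ⟩
      sum (λ v → sum λ k → fresh L v * (w k * f k v))
        ≡⟨ ∑-comm (λ v k → fresh L v * (w k * f k v)) ⟩
      sum (λ k → sum λ v → fresh L v * (w k * f k v))
        ≡⟨ sum-cong-≗ (λ k → sum-cong-≗ λ v → exchange (fresh L v) (w k) (f k v)) ⟩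
      sum (λ k → sum λ v → w k * (fresh L v * f k v))
        ≡⟨ sum-cong-≗ (λ k → *-distribˡ-sum (w k) λ v → fresh L v * f k v) ⟨
      sum (λ k → w k * ∑∉ L (f k)) ∎
      where
      open ≡-Reasoning
      exchange : ∀ a b c → a * (b * c) ≡ b * (a * c)
      exchange = solve-∀

    ∑∉-* : ∀ L c f → ∑∉ L (λ v → c * f v) ≡ c * ∑∉ L f
    ∑∉-* L c f = trans (sum-cong-≗ λ v → exchange (fresh L v) c (f v))
                       (sym (*-distribˡ-sum c λ v → fresh L v * f v))
      where
      exchange : ∀ a b c → a * (b * c) ≡ b * (a * c)
      exchange = solve-∀

    ∑∉-[] : ∀ f → ∑∉ [] f ≡ sum f
    ∑∉-[] f = sum-cong-≗ λ v → ℤ.*-identityˡ (f v)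

  ∑-distinct : ∀ {n} (x : Fin n) f → sum (λ v → distinct x v * f v) + f x ≡ sum f
  ∑-distinct {suc n} zero f = trans
    (cong (_+ f zero) (trans (ℤ.+-identityˡ _) (∑∉-[] (f ∘ suc)))) (ℤ.+-comm (sum (f ∘ suc)) (f zero))
  ∑-distinct {suc n} (suc x) f =
    trans (ℤ.+-assoc (1ℤ * f zero) _ _) (cong₂ _+_ (ℤ.*-identityˡ (f zero)) (∑-distinct x (f ∘ suc)))

  module _ {n : ℕ} where

    ∑∉-∷ : ∀ {L} {x : Fin n} → Fresh L x → ∀ f → ∑∉ (x ∷ L) f + f x ≡ ∑∉ L f
    ∑∉-∷ {L} {x} p f = trans
      (cong₂ _+_ (sum-cong-≗ λ v → ℤ.*-assoc (distinct x v) (fresh L v) (f v))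
                 (sym (trans (cong (_* f x) (Fresh⇒fresh≡1 p)) (ℤ.*-identityˡ (f x)))))
      (∑-distinct x λ v → fresh L v * f v)

    -- The factor `fresh L x * distinct x y * fresh L y` is symmetric in the two vertices.
    ∑∉-comm : ∀ L (f : Fin n → Fin n → ℤ) →
      ∑∉ L (λ x → ∑∉ (x ∷ L) (f x)) ≡ ∑∉ L (λ y → ∑∉ (y ∷ L) λ x → f x y)
    ∑∉-comm L f = begin
      sum (λ x → fresh L x * sum λ y → fresh (x ∷ L) y * f x y)
        ≡⟨ sum-cong-≗ (λ x → *-distribˡ-sum (fresh L x) λ y → fresh (x ∷ L) y * f x y) ⟩
      sum (λ x → sum λ y → fresh L x * (fresh (x ∷ L) y * f x y))
        ≡⟨ ∑-comm (λ x y → fresh L x * (fresh (x ∷ L) y * f x y)) ⟩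
      sum (λ y → sum λ x → fresh L x * (fresh (x ∷ L) y * f x y))
        ≡⟨ sum-cong-≗ (λ y → sum-cong-≗ λ x → exchange x y) ⟩
      sum (λ y → sum λ x → fresh L y * (fresh (y ∷ L) x * f x y))
        ≡⟨ sum-cong-≗ (λ y → *-distribˡ-sum (fresh L y) λ x → fresh (y ∷ L) x * f x y) ⟨
      sum (λ y → fresh L y * sum λ x → fresh (y ∷ L) x * f x y) ∎
      where
      open ≡-Reasoning
      ring : ∀ a d b c → a * (d * b * c) ≡ b * (d * a * c)
      ring = solve-∀
      exchange : ∀ x y → fresh L x * (fresh (x ∷ L) y * f x y) ≡ fresh L y * (fresh (y ∷ L) x * f x y)
      exchange x y rewrite distinct-sym y x = ring (fresh L x) (distinct x y) (fresh L y) (f x y)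

    -- The sum of f over the k-tuples of distinct vertices outside L.
    S : ∀ k → List (Fin n) → (Vec (Fin n) k → ℤ) → ℤ
    S zero    L f = f []
    S (suc k) L f = ∑∉ L λ x → S k (x ∷ L) λ xs → f (x ∷ xs)

    S-+ : ∀ k L f g → S k L (λ xs → f xs + g xs) ≡ S k L f + S k L g
    S-+ zero    L f g = refl
    S-+ (suc k) L f g = trans (∑∉-cong L λ x _ → S-+ k (x ∷ L) _ _)
                              (∑∉-+ L (λ x → S k (x ∷ L) λ xs → f (x ∷ xs)) λ x → S k (x ∷ L) λ xs → g (x ∷ xs))

    S-mono : ∀ k L {f g} → (∀ xs → f xs ≤ g xs) → S k L f ≤ S k L g
    S-mono zero    L f≤g = f≤g []
    S-mono (suc k) L f≤g = ∑∉-mono L λ x _ → S-mono k (x ∷ L) λ xs → f≤g (x ∷ xs)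

    S-cong : ∀ k L {f g} → (∀ xs → f xs ≡ g xs) → S k L f ≡ S k L g
    S-cong k L f≡g = ℤ.≤-antisym (S-mono k L (ℤ.≤-reflexive ∘ f≡g)) (S-mono k L (ℤ.≤-reflexive ∘ sym ∘ f≡g))

    S-zero : ∀ k L → S k L (λ _ → 0ℤ) ≡ 0ℤ
    S-zero zero    L = refl
    S-zero (suc k) L = trans (∑∉-cong L λ x _ → S-zero k (x ∷ L)) (∑∉-* L 0ℤ λ _ → 0ℤ)

    S-fresh : ∀ k {L M} → (∀ v → fresh L v ≡ fresh M v) → ∀ f → S k L f ≡ S k M f
    S-fresh zero    eq f = refl
    S-fresh (suc k) eq f = sum-cong-≗ λ x → cong₂ _*_ (eq x)
      (S-fresh k (λ v → cong (distinct x v *_) (eq v)) λ xs → f (x ∷ xs))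

    swap : ∀ {k} → Vec (Fin n) (suc (suc k)) → Vec (Fin n) (suc (suc k))
    swap (x ∷ y ∷ xs) = y ∷ x ∷ xs

    S-swap : ∀ k L f → S (suc (suc k)) L (f ∘ swap) ≡ S (suc (suc k)) L f
    S-swap k L f = trans
      (∑∉-cong L λ x _ → ∑∉-cong (x ∷ L) λ y _ → S-fresh k (exchange x y) λ xs → f (y ∷ x ∷ xs))
      (∑∉-comm L λ x y → S k (x ∷ y ∷ L) λ xs → f (y ∷ x ∷ xs))
      where
      ring : ∀ a b c → a * (b * c) ≡ b * (a * c)
      ring = solve-∀
      exchange : ∀ x y v → fresh (y ∷ x ∷ L) v ≡ fresh (x ∷ y ∷ L) v
      exchange x y v = ring (distinct y v) (distinct x v) (fresh L v)

    rotate : ∀ {k} → Vec (Fin n) (suc k) → Vec (Fin n) (suc k)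
    rotate (x ∷ xs) = xs ∷ʳ x

    -- A rotation is a swap of the first two entries followed by a rotation of the tail.
    S-rotate : ∀ k L f → S (suc k) L (f ∘ rotate) ≡ S (suc k) L f
    S-rotate zero    L f = refl
    S-rotate (suc k) L f = trans (S-swap k L λ { (x ∷ xs) → f (x ∷ rotate xs) })
      (∑∉-cong L λ x _ → S-rotate k (x ∷ L) λ xs → f (x ∷ xs))

  -- The linear programming certificate

  Colour : Set
  Colour = Fin 3

  _==_ : Colour → Colour → Bool
  0F == 0F = true
  1F == 1F = true
  2F == 2F = true
  _  == _  = false

  ==-refl : ∀ c → (c == c) ≡ true
  ==-refl 0F = refl
  ==-refl 1F = refl
  ==-refl 2F = refl

  ==⇒≡ : ∀ c d → (c == d) ≡ true → c ≡ d
  ==⇒≡ 0F 0F _ = refl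
  ==⇒≡ 1F 1F _ = refl
  ==⇒≡ 2F 2F _ = refl

  -- Summed over all vertices this is positive exactly when fewer than two thirds
  -- of them are hit.
  excess : Bool → ℤ
  excess true  = -1ℤ
  excess false = + 2

  -- The shape of a colour class of K₄, as far as the weights distinguish it.  It
  -- is determined by the numbers of edges and of vertices of degree one.
  data Shape : Set where
    edge matching cherry star triangle path paw other : Shape

  shape : (edges leaves : ℕ) → Shape
  shape 1 _ = edge
  shape 2 4 = matching
  shape 2 2 = cherry
  shape 3 3 = star
  shape 3 2 = path
  shape 3 0 = triangle
  shape 4 1 = paw
  shape _ _ = other

  bit : Bool → ℕ
  bit true  = 1
  bit false = 0

  isLeaf : ℕ → ℕ
  isLeaf 1 = 1
  isLeaf _ = 0

  graphShape : (e₁₂ e₁₃ e₁₄ e₂₃ e₂₄ e₃₄ : ℕ) → Shape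
  graphShape e₁₂ e₁₃ e₁₄ e₂₃ e₂₄ e₃₄ =
    shape (e₁₂ ℕ.+ e₁₃ ℕ.+ e₁₄ ℕ.+ e₂₃ ℕ.+ e₂₄ ℕ.+ e₃₄)
          (isLeaf (e₁₂ ℕ.+ e₁₃ ℕ.+ e₁₄) ℕ.+ isLeaf (e₁₂ ℕ.+ e₂₃ ℕ.+ e₂₄)
            ℕ.+ isLeaf (e₁₃ ℕ.+ e₂₃ ℕ.+ e₃₄) ℕ.+ isLeaf (e₁₄ ℕ.+ e₂₄ ℕ.+ e₃₄))

  classShape : (c q₁₂ q₁₃ q₁₄ q₂₃ q₂₄ q₃₄ : Colour) → Shape
  classShape c q₁₂ q₁₃ q₁₄ q₂₃ q₂₄ q₃₄ =
    graphShape (bit (c == q₁₂)) (bit (c == q₁₃)) (bit (c == q₁₄)) (bit (c == q₂₃)) (bit (c == q₂₄)) (bit (c == q₃₄))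

  -- A solution of the linear program, found by computer: the weight of a colour
  -- class in terms of its shape and the shapes of the two other classes.
  shapeWeight : Shape → Shape → Shape → ℕ
  shapeWeight paw      edge     edge     = 30
  shapeWeight edge     paw      edge     = 3
  shapeWeight edge     edge     paw      = 3
  shapeWeight star     cherry   edge     = 24
  shapeWeight star     edge     cherry   = 24
  shapeWeight cherry   star     edge     = 12
  shapeWeight cherry   edge     star     = 12
  shapeWeight triangle cherry   edge     = 18
  shapeWeight triangle edge     cherry   = 18
  shapeWeight cherry   triangle edge     = 18
  shapeWeight cherry   edge     triangle = 18
  shapeWeight edge     cherry   triangle = 6
  shapeWeight edge     triangle cherry   = 6
  shapeWeight path     matching edge     = 18
  shapeWeight path     edge     matching = 18
  shapeWeight matching path     edge     = 6
  shapeWeight matching edge     path     = 6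
  shapeWeight path     cherry   edge     = 19
  shapeWeight path     edge     cherry   = 19
  shapeWeight cherry   path     edge     = 9
  shapeWeight cherry   edge     path     = 9
  shapeWeight edge     path     cherry   = 8
  shapeWeight edge     cherry   path     = 8
  shapeWeight cherry   cherry   matching = 24
  shapeWeight cherry   matching cherry   = 24
  shapeWeight cherry   cherry   cherry   = 8
  shapeWeight matching matching matching = 8
  shapeWeight _        _        _        = 0

  colourWeight : Shape → Shape → Shape → Colour → ℕ
  colourWeight x y z 0F = shapeWeight x y z
  colourWeight x y z 1F = shapeWeight y x z
  colourWeight x y z 2F = shapeWeight z x y

  excess₃ : (p q r c : Colour) → ℤ
  excess₃ p q r c = excess ((c == p) ∨ (c == q) ∨ (c == r))

  excess₄ : (p q r s c : Colour) → ℤ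
  excess₄ p q r s c = excess ((c == p) ∨ (c == q) ∨ (c == r) ∨ (c == s))

  rainbow : (p q r : Colour) → Bool
  rainbow p q r = not (p == q) ∧ not (p == r) ∧ not (q == r)

  -- Definitionally the sum of the standard library, but much faster to evaluate.
  ∑₃ : (Colour → ℤ) → ℤ
  ∑₃ f = f 0F + (f 1F + (f 2F + 0ℤ))

  weigh : Shape → Shape → Shape → (Colour → ℤ) → ℤ
  weigh x y z f = ∑₃ λ c → + colourWeight x y z c * f c

  weighted : (q₁₂ q₁₃ q₁₄ q₂₃ q₂₄ q₃₄ : Colour) → (Colour → ℤ) → ℤ
  weighted a b c d e f = weigh (classShape 0F a b c d e f) (classShape 1F a b c d e f) (classShape 2F a b c d e f)

  -- The `q` are the edges inside the quadruple, the `l` its edges to the fifth vertex. Similarly,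
  -- in `triTerm` the `l` and `m` are the edges from the triangle to the two other vertices.
  quadTerm : (q₁₂ q₁₃ q₁₄ q₂₃ q₂₄ q₃₄ l₁ l₂ l₃ l₄ : Colour) → ℤ
  quadTerm q₁₂ q₁₃ q₁₄ q₂₃ q₂₄ q₃₄ l₁ l₂ l₃ l₄ = weighted q₁₂ q₁₃ q₁₄ q₂₃ q₂₄ q₃₄ (excess₄ l₁ l₂ l₃ l₄)

  correlation : (l₁ l₂ l₃ m₁ m₂ m₃ : Colour) → ℤ
  correlation l₁ l₂ l₃ m₁ m₂ m₃ = ∑₃ λ c → excess₃ l₁ l₂ l₃ c * excess₃ m₁ m₂ m₃ c

  triTerm : (t₁₂ t₁₃ t₂₃ l₁ l₂ l₃ m₁ m₂ m₃ : Colour) → ℤ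
  triTerm t₁₂ t₁₃ t₂₃ l₁ l₂ l₃ m₁ m₂ m₃ =
    if rainbow t₁₂ t₁₃ t₂₃ then + 4 * correlation l₁ l₂ l₃ m₁ m₂ m₃ else 0ℤ

  -- The ten triangles of K₅ form two orbits under cyclic rotation, represented by 123 and 124. With
  -- one term for each, the sum over the five rotations is already fully symmetric.
  term₅ : (c₁₂ c₁₃ c₁₄ c₁₅ c₂₃ c₂₄ c₂₅ c₃₄ c₃₅ c₄₅ : Colour) → ℤ
  term₅ c₁₂ c₁₃ c₁₄ c₁₅ c₂₃ c₂₄ c₂₅ c₃₄ c₃₅ c₄₅ =
    quadTerm c₁₂ c₁₃ c₁₄ c₂₃ c₂₄ c₃₄ c₁₅ c₂₅ c₃₅ c₄₅
    + (triTerm c₁₂ c₁₃ c₂₃ c₁₄ c₂₄ c₃₄ c₁₅ c₂₅ c₃₅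
    +  triTerm c₁₂ c₁₄ c₂₄ c₁₃ c₂₃ c₃₄ c₁₅ c₂₅ c₄₅)

  rotations₅ : (c₁₂ c₁₃ c₁₄ c₁₅ c₂₃ c₂₄ c₂₅ c₃₄ c₃₅ c₄₅ : Colour) → ℤ
  rotations₅ c₁₂ c₁₃ c₁₄ c₁₅ c₂₃ c₂₄ c₂₅ c₃₄ c₃₅ c₄₅ =
      term₅ c₁₂ c₁₃ c₁₄ c₁₅ c₂₃ c₂₄ c₂₅ c₃₄ c₃₅ c₄₅
    + (term₅ c₂₃ c₂₄ c₂₅ c₁₂ c₃₄ c₃₅ c₁₃ c₄₅ c₁₄ c₁₅
    + (term₅ c₃₄ c₃₅ c₁₃ c₂₃ c₄₅ c₁₄ c₂₄ c₁₅ c₂₅ c₁₂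
    + (term₅ c₄₅ c₁₄ c₂₄ c₃₄ c₁₅ c₂₅ c₃₅ c₁₂ c₁₃ c₂₃
    +  term₅ c₁₅ c₂₅ c₃₅ c₄₅ c₁₂ c₁₃ c₁₄ c₂₃ c₂₄ c₃₄)))

  -- A domination hypothesis counts all vertices, so the excess of the four
  -- vertices themselves has to be subtracted.
  inner : (q₁₂ q₁₃ q₁₄ q₂₃ q₂₄ q₃₄ c : Colour) → ℤ
  inner q₁₂ q₁₃ q₁₄ q₂₃ q₂₄ q₃₄ c =
    excess₃ q₁₂ q₁₃ q₁₄ c + (excess₃ q₁₂ q₂₃ q₂₄ c + (excess₃ q₁₃ q₂₃ q₃₄ c + excess₃ q₁₄ q₂₄ q₃₄ c))

  -- The `1ℤ` is the assumed lower bound on the total excess over all vertices.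
  quadBound : (q₁₂ q₁₃ q₁₄ q₂₃ q₂₄ q₃₄ : Colour) → ℤ
  quadBound q₁₂ q₁₃ q₁₄ q₂₃ q₂₄ q₃₄ =
    weighted q₁₂ q₁₃ q₁₄ q₂₃ q₂₄ q₃₄ (λ c → 1ℤ - inner q₁₂ q₁₃ q₁₄ q₂₃ q₂₄ q₃₄ c)

  -- Summed over all ordered pairs of vertices outside the triangle, `triTerm` is nonnegative;
  -- without the diagonal it is at least minus the diagonal.
  triBound : (t₁₂ t₁₃ t₂₃ l₁ l₂ l₃ : Colour) → ℤ
  triBound t₁₂ t₁₃ t₂₃ l₁ l₂ l₃ = - triTerm t₁₂ t₁₃ t₂₃ l₁ l₂ l₃ l₁ l₂ l₃

  -- The triangle bound enters twice because `term₅` has two triangle terms, whose totals agree.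
  bound₄ : (q₁₂ q₁₃ q₁₄ q₂₃ q₂₄ q₃₄ : Colour) → ℤ
  bound₄ q₁₂ q₁₃ q₁₄ q₂₃ q₂₄ q₃₄ =
    quadBound q₁₂ q₁₃ q₁₄ q₂₃ q₂₄ q₃₄
    + (triBound q₁₂ q₁₃ q₂₃ q₁₄ q₂₄ q₃₄ + triBound q₁₂ q₁₃ q₂₃ q₁₄ q₂₄ q₃₄)

  rotations₄ : (q₁₂ q₁₃ q₁₄ q₂₃ q₂₄ q₃₄ : Colour) → ℤ
  rotations₄ q₁₂ q₁₃ q₁₄ q₂₃ q₂₄ q₃₄ =
      bound₄ q₁₂ q₁₃ q₁₄ q₂₃ q₂₄ q₃₄
    + (bound₄ q₂₃ q₂₄ q₁₂ q₃₄ q₁₃ q₁₄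
    + (bound₄ q₃₄ q₁₃ q₂₃ q₁₄ q₂₄ q₁₂
    +  bound₄ q₁₄ q₂₄ q₃₄ q₁₂ q₁₃ q₂₃))

  rainbowStar : (q₁₂ q₁₃ q₁₄ : Colour) → ℤ
  rainbowStar q₁₂ q₁₃ q₁₄ = if rainbow q₁₂ q₁₃ q₁₄ then 1ℤ else 0ℤ

  -- Exhaustive verification of the certificate

  every : ∀ k → (Vec Colour k → Bool) → Bool
  every zero    p = p []
  every (suc k) p = every k (p ∘ (0F ∷_)) ∧ every k (p ∘ (1F ∷_)) ∧ every k (p ∘ (2F ∷_))

  every-sound : ∀ k p → every k p ≡ true → ∀ v → p v ≡ true
  every-sound zero    p eq []       = eq
  every-sound (suc k) p eq (0F ∷ v) = every-sound k _ (Bool.∧-conicalˡ _ _ eq) v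
  every-sound (suc k) p eq (1F ∷ v) =
    every-sound k _ (Bool.∧-conicalˡ _ _ (Bool.∧-conicalʳ (every k (p ∘ (0F ∷_))) _ eq)) v
  every-sound (suc k) p eq (2F ∷ v) =
    every-sound k _ (Bool.∧-conicalʳ (every k (p ∘ (1F ∷_))) _ (Bool.∧-conicalʳ (every k (p ∘ (0F ∷_))) _ eq)) v

  rotations₅-check : Vec Colour 10 → Bool
  rotations₅-check (a ∷ b ∷ c ∷ d ∷ e ∷ f ∷ g ∷ h ∷ i ∷ j ∷ []) = rotations₅ a b c d e f g h i j ≤ᵇ 0ℤ

  rotations₄-check : Vec Colour 6 → Bool
  rotations₄-check (a ∷ b ∷ c ∷ d ∷ e ∷ f ∷ []) = rainbowStar a b c ≤ᵇ rotations₄ a b c d e f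

  ≤ᵇ-sound : ∀ {i j} → (i ≤ᵇ j) ≡ true → i ≤ j
  ≤ᵇ-sound = ℤ.≤ᵇ⇒≤ ∘ Equivalence.from Bool.T-≡

  abstract

    -- Evaluation on all 3^10 = 59049 colourings of K₅.
    rotations₅-holds : every 10 rotations₅-check ≡ true
    rotations₅-holds = refl

    rotations₄-holds : every 6 rotations₄-check ≡ true
    rotations₄-holds = refl

  rotations₅≤0 : ∀ a b c d e f g h i j → rotations₅ a b c d e f g h i j ≤ 0ℤ
  rotations₅≤0 a b c d e f g h i j =
    ≤ᵇ-sound (every-sound 10 rotations₅-check rotations₅-holds (a ∷ b ∷ c ∷ d ∷ e ∷ f ∷ g ∷ h ∷ i ∷ j ∷ []))

  -- The source of strictness: a vertex that sees three colours makes the lower bound positive.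
  rotations₄≥star : ∀ a b c d e f → rainbowStar a b c ≤ rotations₄ a b c d e f
  rotations₄≥star a b c d e f = ≤ᵇ-sound (every-sound 6 rotations₄-check rotations₄-holds (a ∷ b ∷ c ∷ d ∷ e ∷ f ∷ []))

  -- Positivity and cyclic symmetrisation

  square-nonNeg : ∀ i → 0ℤ ≤ i * i
  square-nonNeg (+ n)    = subst (0ℤ ≤_) (ℤ.pos-* n n) (+≤+ z≤n)
  square-nonNeg -[1+ n ] = +≤+ z≤n

  ∑-nonNeg : ∀ {m} {f : Fin m → ℤ} → (∀ i → 0ℤ ≤ f i) → 0ℤ ≤ sum f
  ∑-nonNeg {zero}  0≤f = ℤ.≤-refl
  ∑-nonNeg {suc m} 0≤f = ℤ.+-mono-≤ (0≤f zero) (∑-nonNeg (0≤f ∘ suc))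

  module _ {n : ℕ} where

    -- Adding the diagonal completes the right hand side to a sum of squares.
    offDiagonal : ∀ {m} L (E : Fin m → Fin n → ℤ) →
      - ∑∉ L (λ v → sum λ k → E k v * E k v) ≤ ∑∉ L λ v → ∑∉ (v ∷ L) λ w → sum λ k → E k v * E k w
    offDiagonal L E = subst₂ _≤_ (ℤ.+-identityˡ _) (cancel _ _) (ℤ.+-monoˡ-≤ (- diagonal) total≥0)
      where
      open ≡-Reasoning
      t : Fin n → Fin n → ℤ
      t v w = sum λ k → E k v * E k w

      diagonal = ∑∉ L λ v → t v v

      total : ∑∉ L (λ v → ∑∉ (v ∷ L) (t v)) + diagonal ≡ sum λ k → ∑∉ L (E k) * ∑∉ L (E k)
      total = begin
        ∑∉ L (λ v → ∑∉ (v ∷ L) (t v)) + diagonal           ≡⟨ ∑∉-+ L (λ v → ∑∉ (v ∷ L) (t v)) (λ v → t v v) ⟨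
        ∑∉ L (λ v → ∑∉ (v ∷ L) (t v) + t v v)              ≡⟨ ∑∉-cong L (λ v p → ∑∉-∷ p (t v)) ⟩
        ∑∉ L (λ v → ∑∉ L (t v))                            ≡⟨ ∑∉-cong L (λ v _ → ∑∉-linear L (λ k → E k v) E) ⟩
        ∑∉ L (λ v → sum λ k → E k v * ∑∉ L (E k))
          ≡⟨ ∑∉-cong L (λ v _ → sum-cong-≗ λ k → ℤ.*-comm (E k v) (∑∉ L (E k))) ⟩
        ∑∉ L (λ v → sum λ k → ∑∉ L (E k) * E k v)          ≡⟨ ∑∉-linear L (λ k → ∑∉ L (E k)) E ⟩
        sum (λ k → ∑∉ L (E k) * ∑∉ L (E k)) ∎

      total≥0 : 0ℤ ≤ ∑∉ L (λ v → ∑∉ (v ∷ L) (t v)) + diagonal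
      total≥0 = subst (0ℤ ≤_) (sym total) (∑-nonNeg λ k → square-nonNeg (∑∉ L (E k)))

      cancel : ∀ x y → x + y + - y ≡ x
      cancel = solve-∀

    DistinctOutside : ∀ {k} → List (Fin n) → Vec (Fin n) k → Set
    DistinctOutside L []       = ⊤
    DistinctOutside L (x ∷ xs) = Fresh L x × DistinctOutside (x ∷ L) xs

    ∑∉-nonNeg : ∀ L {f : Fin n → ℤ} → (∀ v → 0ℤ ≤ f v) → 0ℤ ≤ ∑∉ L f
    ∑∉-nonNeg L {f} 0≤f = subst (_≤ ∑∉ L f) (∑∉-* L 0ℤ λ _ → 0ℤ) (∑∉-mono L λ v _ → 0≤f v)

    S-nonNeg : ∀ k L {f : Vec (Fin n) k → ℤ} → (∀ xs → 0ℤ ≤ f xs) → 0ℤ ≤ S k L f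
    S-nonNeg zero    L 0≤f = 0≤f []
    S-nonNeg (suc k) L 0≤f = ∑∉-nonNeg L λ x → S-nonNeg k (x ∷ L) λ xs → 0≤f (x ∷ xs)

    -- At each level the entry of `xs` is split off and the nonnegative rest is dropped. This lets a
    -- single rainbow star force a positive sum.
    term≤S : ∀ {k L f} {xs : Vec (Fin n) k} → (∀ ys → 0ℤ ≤ f ys) → DistinctOutside L xs → f xs ≤ S k L f
    term≤S {xs = []} 0≤f _ = ℤ.≤-refl
    term≤S {suc k} {L} {f} {x ∷ xs} 0≤f (p , d) = begin
      f (x ∷ xs)                ≤⟨ term≤S (λ ys → 0≤f (x ∷ ys)) d ⟩
      g x                       ≡⟨ ℤ.+-identityˡ (g x) ⟨
      0ℤ + g x                  ≤⟨ ℤ.+-monoˡ-≤ (g x) 0≤rest ⟩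
      ∑∉ (x ∷ L) g + g x        ≡⟨ ∑∉-∷ p g ⟩
      ∑∉ L g                    ∎
      where
      open ℤ.≤-Reasoning
      g : Fin n → ℤ
      g y = S k (y ∷ L) λ ys → f (y ∷ ys)

      0≤rest : 0ℤ ≤ ∑∉ (x ∷ L) g
      0≤rest = ∑∉-nonNeg (x ∷ L) λ y → S-nonNeg k (y ∷ L) λ ys → 0≤f (y ∷ ys)

  rainbowWeight : (p q r : Colour) → ℤ
  rainbowWeight p q r = if rainbow p q r then + 4 else 0ℤ

  -- Separates a nonnegative factor, constant for a fixed triangle, from the scalar product to which
  -- `offDiagonal` applies.
  triTerm-factor : ∀ p q r l₁ l₂ l₃ m₁ m₂ m₃ →
    triTerm p q r l₁ l₂ l₃ m₁ m₂ m₃ ≡ rainbowWeight p q r * correlation l₁ l₂ l₃ m₁ m₂ m₃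
  triTerm-factor p q r l₁ l₂ l₃ m₁ m₂ m₃ with rainbow p q r
  ... | true  = refl
  ... | false = sym (ℤ.*-zeroˡ (correlation l₁ l₂ l₃ m₁ m₂ m₃))

  rainbowWeight-nonNeg : ∀ p q r → NonNegative (rainbowWeight p q r)
  rainbowWeight-nonNeg p q r with rainbow p q r
  ... | true  = _
  ... | false = _

  rainbowStar-nonNeg : ∀ p q r → 0ℤ ≤ rainbowStar p q r
  rainbowStar-nonNeg p q r with rainbow p q r
  ... | true  = +≤+ z≤n
  ... | false = +≤+ z≤n

  module _ {n : ℕ} where

    -- There are `m + 1` summands, so `orbit 4` covers all rotations of a 5-tuple and `orbit 3`
    -- those of a 4-tuple.
    orbit : ∀ {k} → ℕ → (Vec (Fin n) (suc k) → ℤ) → Vec (Fin n) (suc k) → ℤ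
    orbit zero    f xs = f xs
    orbit (suc m) f xs = f xs + orbit m f (rotate xs)

    S-orbit : ∀ {k} m L f → S (suc k) L (orbit m f) ≡ + suc m * S (suc k) L f
    S-orbit         zero    L f = sym (ℤ.*-identityˡ _)
    S-orbit {k = k} (suc m) L f = begin
      S (suc k) L (λ xs → f xs + orbit m f (rotate xs))        ≡⟨ S-+ (suc k) L f (orbit m f ∘ rotate) ⟩
      S (suc k) L f + S (suc k) L (orbit m f ∘ rotate)         ≡⟨ cong (λ s → S (suc k) L f + s) (S-rotate k L (orbit m f)) ⟩
      S (suc k) L f + S (suc k) L (orbit m f)                  ≡⟨ cong (λ s → S (suc k) L f + s) (S-orbit m L f) ⟩
      S (suc k) L f + + suc m * S (suc k) L f                  ≡⟨ ℤ.suc-* (+ suc m) (S (suc k) L f) ⟨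
      + suc (suc m) * S (suc k) L f                            ∎
      where open ≡-Reasoning

  -- Facts on colours and counting for the final contradictions

  ∑-nonPos : ∀ {m} {f : Fin m → ℤ} → (∀ i → f i ≤ 0ℤ) → sum f ≤ 0ℤ
  ∑-nonPos {zero}  f≤0 = ℤ.≤-refl
  ∑-nonPos {suc m} f≤0 = ℤ.+-mono-≤ (f≤0 zero) (∑-nonPos (f≤0 ∘ suc))

  ∑-one : ∀ m → sum {m} (λ _ → 1ℤ) ≡ + m
  ∑-one zero    = refl
  ∑-one (suc m) = cong (λ s → 1ℤ + s) (∑-one m)

  ∃-unhit : ∀ {m} (b : Fin m → Bool) → 1ℤ ≤ sum (excess ∘ b) → ∃[ v ] b v ≡ false
  ∃-unhit b 1≤ with any? (λ v → b v Bool.≟ false)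
  ... | yes found = found
  ... | no none   = contradiction (ℤ.≤-trans 1≤ (∑-nonPos λ v → hit≤0 (b v) (none ∘ (v ,_)))) λ { (+≤+ ()) }
    where
    hit≤0 : ∀ h → h ≢ false → excess h ≤ 0ℤ
    hit≤0 true  _ = -≤+
    hit≤0 false p = contradiction refl p

  ≢⇒== : ∀ {c d} → c ≢ d → (c == d) ≡ false
  ≢⇒== {c} {d} c≢d with c == d in eq
  ... | true  = contradiction (==⇒≡ c d eq) c≢d
  ... | false = refl

  thirdColour : ∀ {a b : Colour} → a ≢ b → ∃[ c ] a ≢ c × b ≢ c
  thirdColour {0F} {0F} a≢b = contradiction refl a≢b
  thirdColour {0F} {1F} _   = 2F , (λ ()) , (λ ())
  thirdColour {0F} {2F} _   = 1F , (λ ()) , (λ ())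
  thirdColour {1F} {0F} _   = 2F , (λ ()) , (λ ())
  thirdColour {1F} {1F} a≢b = contradiction refl a≢b
  thirdColour {1F} {2F} _   = 0F , (λ ()) , (λ ())
  thirdColour {2F} {0F} _   = 1F , (λ ()) , (λ ())
  thirdColour {2F} {1F} _   = 0F , (λ ()) , (λ ())
  thirdColour {2F} {2F} a≢b = contradiction refl a≢b

  -- Pigeonhole: two of any four colours coincide, and the hypotheses exclude five of the six pairs.
  third-unique : ∀ {a b c d : Colour} → a ≢ b → a ≢ c → b ≢ c → a ≢ d → b ≢ d → (c == d) ≡ true
  third-unique {a} {b} {c} {d} a≢b a≢c b≢c a≢d b≢d = conclude (every-sound 4 check refl (a ∷ b ∷ c ∷ d ∷ []))
    where
    check : Vec Colour 4 → Bool
    check (a ∷ b ∷ c ∷ d ∷ []) = (a == b) ∨ (a == c) ∨ (b == c) ∨ (a == d) ∨ (b == d) ∨ (c == d)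
    conclude : check (a ∷ b ∷ c ∷ d ∷ []) ≡ true → (c == d) ≡ true
    conclude eq rewrite ≢⇒== a≢b | ≢⇒== a≢c | ≢⇒== b≢c | ≢⇒== a≢d | ≢⇒== b≢d = eq

  indicator : Bool → ℤ
  indicator b = + bit b

  indicator-nonNeg : ∀ b → 0ℤ ≤ indicator b
  indicator-nonNeg b = +≤+ z≤n

  -- With s = x + y: s² < s m ≤ 3 x y ≤ 4 x y ≤ s².
  productTooSmall : ∀ {m x y} → 0ℤ < x → 0ℤ ≤ y → x + y < m → ¬ (m * (x + y) ≤ + 3 * (x * y))
  productTooSmall {m} {x} {y} 0<x 0≤y s<m h = ℤ.<-irrefl refl (begin-strict
    s * s                                     <⟨ ℤ.*-monoʳ-<-pos s {{positive 0<s}} s<m ⟩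
    m * s                                     ≤⟨ h ⟩
    + 3 * (x * y)                             ≡⟨ ℤ.+-identityʳ _ ⟨
    + 3 * (x * y) + 0ℤ                        ≤⟨ ℤ.+-monoʳ-≤ (+ 3 * (x * y)) 0≤rest ⟩
    + 3 * (x * y) + (x * y + (x - y) * (x - y)) ≡⟨ ring x y ⟩
    s * s                                     ∎)
    where
    open ℤ.≤-Reasoning
    s = x + y
    0<s : 0ℤ < s
    0<s = ℤ.+-mono-<-≤ 0<x 0≤y
    0≤rest : 0ℤ ≤ x * y + (x - y) * (x - y)
    0≤rest = ℤ.+-mono-≤
      (ℤ.≤-trans (ℤ.≤-reflexive (sym (ℤ.*-zeroʳ x))) (ℤ.*-monoˡ-≤-nonNeg x {{nonNegative (ℤ.<⇒≤ 0<x)}} 0≤y))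
      (square-nonNeg (x - y))
    ring : ∀ x y → + 3 * (x * y) + (x * y + (x - y) * (x - y)) ≡ (x + y) * (x + y)
    ring = solve-∀

  -- Every pair in D × E is counted exactly once, in its row or in its column.
  doubleCount : ∀ {n} (m : ℤ) (D E : Fin n → Bool) (R : Fin n → Fin n → Bool) →
    (∀ d → D d ≡ true → m ≤ + 3 * sum λ e → indicator (E e ∧ R d e)) →
    (∀ e → E e ≡ true → m ≤ + 3 * sum λ d → indicator (D d ∧ not (R d e))) →
    m * (sum (indicator ∘ D) + sum (indicator ∘ E)) ≤ + 3 * (sum (indicator ∘ D) * sum (indicator ∘ E))
  doubleCount {n} m D E R rowBound columnBound = begin
    m * (sum iD + sum iE)                                ≡⟨ ℤ.*-distribˡ-+ m (sum iD) (sum iE) ⟩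
    m * sum iD + m * sum iE                              ≤⟨ ℤ.+-mono-≤ rows columns ⟩
    + 3 * sum (λ d → sum λ e → A d e) + + 3 * sum (λ e → sum λ d → B d e)
      ≡⟨ cong (λ s → + 3 * sum (λ d → sum λ e → A d e) + + 3 * s) (∑-comm (λ e d → B d e)) ⟩
    + 3 * sum (λ d → sum λ e → A d e) + + 3 * sum (λ d → sum λ e → B d e)
      ≡⟨ ℤ.*-distribˡ-+ (+ 3) (sum λ d → sum λ e → A d e) (sum λ d → sum λ e → B d e) ⟨
    + 3 * (sum (λ d → sum λ e → A d e) + sum (λ d → sum λ e → B d e))
      ≡⟨ cong (+ 3 *_) (trans (sym (∑-distrib-+ (λ d → sum (A d)) (λ d → sum (B d))))
          (sum-cong-≗ λ d → trans (sym (∑-distrib-+ (A d) (B d)))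
            (trans (sum-cong-≗ λ e → complete d e) (sym (*-distribˡ-sum (iD d) iE))))) ⟩
    + 3 * sum (λ d → iD d * sum iE)                      ≡⟨ cong (+ 3 *_) (*-distribʳ-sum (sum iE) iD) ⟨
    + 3 * (sum iD * sum iE)                              ∎
    where
    open ℤ.≤-Reasoning
    iD iE : Fin n → ℤ
    iD = indicator ∘ D
    iE = indicator ∘ E
    A B : Fin n → Fin n → ℤ
    A d e = iD d * indicator (E e ∧ R d e)
    B d e = iE e * indicator (D d ∧ not (R d e))

    complete : ∀ d e → A d e + B d e ≡ iD d * iE e
    complete d e with D d | E e | R d e
    ... | true  | true  | true  = refl
    ... | true  | true  | false = refl
    ... | true  | false | _     = refl
    ... | false | true  | _     = refl
    ... | false | false | _     = refl

    rowSum : ∀ (X : Fin n → Bool) (f : Fin n → Fin n → ℤ) → (∀ x → X x ≡ true → m ≤ + 3 * sum (f x)) →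
      m * sum (indicator ∘ X) ≤ + 3 * sum λ x → sum λ y → indicator (X x) * f x y
    rowSum X f bound = begin
      m * sum (indicator ∘ X)                               ≡⟨ *-distribˡ-sum m (indicator ∘ X) ⟩
      sum (λ x → m * indicator (X x))                       ≤⟨ ∑-mono pointwise ⟩
      sum (λ x → + 3 * sum λ y → indicator (X x) * f x y)
        ≡⟨ *-distribˡ-sum (+ 3) (λ x → sum λ y → indicator (X x) * f x y) ⟨
      + 3 * sum (λ x → sum λ y → indicator (X x) * f x y)   ∎
      where
      pointwise : ∀ x → m * indicator (X x) ≤ + 3 * sum λ y → indicator (X x) * f x y
      pointwise x rewrite sym (*-distribˡ-sum (indicator (X x)) (f x)) with X x in eq
      ... | true  = subst₂ _≤_ (sym (ℤ.*-identityʳ m)) (cong (+ 3 *_) (sym (ℤ.*-identityˡ (sum (f x))))) (bound x eq)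
      ... | false = ℤ.≤-reflexive (ℤ.*-zeroʳ m)

    rows : m * sum iD ≤ + 3 * sum (λ d → sum λ e → A d e)
    rows = rowSum D (λ d e → indicator (E e ∧ R d e)) rowBound
    columns : m * sum iE ≤ + 3 * sum (λ e → sum λ d → B d e)
    columns = rowSum E (λ e d → indicator (D d ∧ not (R d e))) columnBound

  -- Cardinalities of subsets and total excess

  ∣p∪q∣≤∣p∣+∣q∣ : ∀ {n} (p q : Subset n) → ∣ p ∪ q ∣ ℕ.≤ ∣ p ∣ ℕ.+ ∣ q ∣
  ∣p∪q∣≤∣p∣+∣q∣ []          []          = z≤n
  ∣p∪q∣≤∣p∣+∣q∣ (true  ∷ p) (true  ∷ q) = s≤s (ℕ.≤-trans (∣p∪q∣≤∣p∣+∣q∣ p q) (ℕ.+-monoʳ-≤ ∣ p ∣ (ℕ.n≤1+n ∣ q ∣)))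
  ∣p∪q∣≤∣p∣+∣q∣ (true  ∷ p) (false ∷ q) = s≤s (∣p∪q∣≤∣p∣+∣q∣ p q)
  ∣p∪q∣≤∣p∣+∣q∣ (false ∷ p) (true  ∷ q) = subst (ℕ.suc ∣ p ∪ q ∣ ℕ.≤_) (sym (ℕ.+-suc ∣ p ∣ ∣ q ∣)) (s≤s (∣p∪q∣≤∣p∣+∣q∣ p q))
  ∣p∪q∣≤∣p∣+∣q∣ (false ∷ p) (false ∷ q) = ∣p∪q∣≤∣p∣+∣q∣ p q

  -- Every vertex starts with 2, and being hit costs it 3.
  ∑-excess : ∀ {n} (b : Fin n → Bool) → sum (excess ∘ b) + + 3 * + ∣ tabulate b ∣ ≡ + 2 * + n
  ∑-excess {zero}  b = refl
  ∑-excess {suc n} b = trans (step (b zero)) (trans (cong (λ s → + 2 + s) (∑-excess (b ∘ suc))) (sym (double (+ n))))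
    where
    s = sum (excess ∘ b ∘ suc)
    t = tabulate (b ∘ suc)
    inside : ∀ s t → -1ℤ + s + + 3 * (1ℤ + t) ≡ + 2 + (s + + 3 * t)
    inside = solve-∀
    double : ∀ m → + 2 * (1ℤ + m) ≡ + 2 + + 2 * m
    double = solve-∀
    step : ∀ h → excess h + s + + 3 * + ∣ h ∷ t ∣ ≡ + 2 + (s + + 3 * + ∣ t ∣)
    step true  = inside s (+ ∣ t ∣)
    step false = ℤ.+-assoc (+ 2) s (+ 3 * + ∣ t ∣)

  fewHit : ∀ {n} (b : Fin n → Bool) → ¬ (2 ℕ.* n ℕ.≤ 3 ℕ.* ∣ tabulate b ∣) → 1ℤ ≤ sum (excess ∘ b)
  fewHit {n} b few = subst₂ _≤_ (cancel 1ℤ (+ 3 * + t)) (cancel (sum (excess ∘ b)) (+ 3 * + t)) (ℤ.+-monoˡ-≤ (- (+ 3 * + t)) (begin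
    1ℤ + + 3 * + t                ≡⟨ cong (λ s → 1ℤ + s) (ℤ.pos-* 3 t) ⟨
    -- Integrality turns the strict inequality into a gap of at least 1.
    + suc (3 ℕ.* t)               ≤⟨ +≤+ (ℕ.≰⇒> few) ⟩
    + (2 ℕ.* n)                   ≡⟨ ℤ.pos-* 2 n ⟩
    + 2 * + n                     ≡⟨ ∑-excess b ⟨
    sum (excess ∘ b) + + 3 * + t  ∎))
    where
    cancel : ∀ x y → x + y + - y ≡ x
    cancel = solve-∀
    open ℤ.≤-Reasoning
    t = ∣ tabulate b ∣

  -- The weighted sum of a colouring

  module Counting {n : ℕ} (χ : EdgeColouring 3 n) where

    open EdgeColouring χ

    -- No vertex hits itself, so the set of vertices hit by members of a set is strongly dominated
    -- by it.
    hit : Colour → Fin n → Fin n → Bool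
    hit c x v = not (does (x ≟ v)) ∧ (c == colour x v)

    hit-irrefl : ∀ c x → hit c x x ≡ false
    hit-irrefl c x with x ≟ x
    ... | yes _  = refl
    ... | no x≢x = contradiction refl x≢x

    hit-≢ : ∀ c {x v} → x ≢ v → hit c x v ≡ (c == colour x v)
    hit-≢ c {x} {v} x≢v with x ≟ v
    ... | yes x≡v = contradiction x≡v x≢v
    ... | no _    = refl

    hit-sym : ∀ c x v → hit c x v ≡ hit c v x
    hit-sym c x v with x ≟ v | v ≟ x
    ... | yes _    | yes _    = refl
    ... | no _     | no _     = cong (c ==_) (colour-sym x v)
    ... | yes refl | no v≢v   = contradiction refl v≢v
    ... | no x≢x   | yes refl = contradiction refl x≢x

    hit⇒Joined : ∀ c x v → hit c x v ≡ true → Joined χ c x v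
    hit⇒Joined c x v eq with x ≟ v
    ... | no x≢v = x≢v , sym (==⇒≡ c (colour x v) eq)

    -- Repetitions among the four vertices are allowed, which covers the smaller sets.
    hits : Colour → (a b d e : Fin n) → Fin n → Bool
    hits c a b d e v = hit c a v ∨ hit c b v ∨ hit c d v ∨ hit c e v

    onK₅ : (Colour → Colour → Colour → Colour → Colour → Colour → Colour → Colour → Colour → Colour → ℤ) →
      Vec (Fin n) 5 → ℤ
    onK₅ f (a ∷ b ∷ c ∷ d ∷ e ∷ []) =
      f (colour a b) (colour a c) (colour a d) (colour a e) (colour b c)
        (colour b d) (colour b e) (colour c d) (colour c e) (colour d e)

    onK₄ : (Colour → Colour → Colour → Colour → Colour → Colour → ℤ) → Vec (Fin n) 4 → ℤ
    onK₄ f (a ∷ b ∷ c ∷ d ∷ []) =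
      f (colour a b) (colour a c) (colour a d) (colour b c) (colour b d) (colour c d)

    quad₅ tri₅ : Vec (Fin n) 5 → ℤ
    quad₅ (a ∷ b ∷ c ∷ d ∷ e ∷ []) =
      quadTerm (colour a b) (colour a c) (colour a d) (colour b c) (colour b d) (colour c d)
               (colour a e) (colour b e) (colour c e) (colour d e)
    tri₅ (a ∷ b ∷ c ∷ d ∷ e ∷ []) =
      triTerm (colour a b) (colour a c) (colour b c)
              (colour a d) (colour b d) (colour c d) (colour a e) (colour b e) (colour c e)

    tri₄ : Vec (Fin n) 4 → ℤ
    tri₄ (a ∷ b ∷ c ∷ d ∷ []) =
      triBound (colour a b) (colour a c) (colour b c) (colour a d) (colour b d) (colour c d)

    swap₃₄ : Vec (Fin n) 5 → Vec (Fin n) 5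
    swap₃₄ (a ∷ b ∷ xs) = a ∷ b ∷ swap xs

    term₅-split : ∀ xs → onK₅ term₅ xs ≡ quad₅ xs + (tri₅ xs + tri₅ (swap₃₄ xs))
    term₅-split (a ∷ b ∷ c ∷ d ∷ e ∷ []) =
      cong (λ k → quad₅ (a ∷ b ∷ c ∷ d ∷ e ∷ []) + (tri₅ (a ∷ b ∷ c ∷ d ∷ e ∷ []) +
        triTerm (colour a b) (colour a d) (colour b d) (colour a c) (colour b c) k (colour a e) (colour b e) (colour d e)))
        (colour-sym c d)

    -- Exchanging the third and fourth vertices carries the triangle 124 to 123, so both triangle
    -- terms have the same total.
    S-term₅ : S 5 [] (onK₅ term₅) ≡ S 5 [] quad₅ + (S 5 [] tri₅ + S 5 [] tri₅)
    S-term₅ = begin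
      S 5 [] (onK₅ term₅)
        ≡⟨ S-cong 5 [] term₅-split ⟩
      S 5 [] (λ xs → quad₅ xs + (tri₅ xs + tri₅ (swap₃₄ xs)))
        ≡⟨ S-+ 5 [] quad₅ (λ xs → tri₅ xs + tri₅ (swap₃₄ xs)) ⟩
      S 5 [] quad₅ + S 5 [] (λ xs → tri₅ xs + tri₅ (swap₃₄ xs))
        ≡⟨ cong (λ s → S 5 [] quad₅ + s) (S-+ 5 [] tri₅ (tri₅ ∘ swap₃₄)) ⟩
      S 5 [] quad₅ + (S 5 [] tri₅ + S 5 [] (tri₅ ∘ swap₃₄))
        ≡⟨ cong (λ s → S 5 [] quad₅ + (S 5 [] tri₅ + s)) swapped ⟩
      S 5 [] quad₅ + (S 5 [] tri₅ + S 5 [] tri₅) ∎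
      where
      open ≡-Reasoning
      swapped : S 5 [] (tri₅ ∘ swap₃₄) ≡ S 5 [] tri₅
      swapped = ∑∉-cong [] λ a _ → ∑∉-cong (a ∷ []) λ b _ → S-swap 1 (b ∷ a ∷ []) λ xs → tri₅ (a ∷ b ∷ xs)

    -- For a fixed triangle the weight `ρ` is constant and nonnegative, and `offDiagonal` bounds the
    -- sum over the two other vertices.
    S-tri₅ : S 4 [] tri₄ ≤ S 5 [] tri₅
    S-tri₅ = ∑∉-mono [] λ a _ → ∑∉-mono (a ∷ []) λ b _ → ∑∉-mono (b ∷ a ∷ []) λ c _ → bound a b c
      where
      open ℤ.≤-Reasoning
      bound : ∀ a b c → let L = c ∷ b ∷ a ∷ [] in
        ∑∉ L (λ d → tri₄ (a ∷ b ∷ c ∷ d ∷ [])) ≤ ∑∉ L λ d → ∑∉ (d ∷ L) λ e → tri₅ (a ∷ b ∷ c ∷ d ∷ e ∷ [])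
      bound a b c = begin
        ∑∉ L (λ d → - tri d d)                   ≡⟨ ∑∉-cong L (λ d _ → trans (cong -_ (factor d d)) (pull ρ (t d d))) ⟩
        ∑∉ L (λ d → - ρ * t d d)                 ≡⟨ ∑∉-* L (- ρ) (λ d → t d d) ⟩
        - ρ * ∑∉ L (λ d → t d d)                 ≡⟨ push ρ _ ⟩
        ρ * - ∑∉ L (λ d → t d d)
          ≤⟨ ℤ.*-monoˡ-≤-nonNeg ρ {{rainbowWeight-nonNeg (colour a b) (colour a c) (colour b c)}} (offDiagonal L E) ⟩
        ρ * ∑∉ L (λ d → ∑∉ (d ∷ L) (t d))        ≡⟨ ∑∉-* L ρ (λ d → ∑∉ (d ∷ L) (t d)) ⟨
        ∑∉ L (λ d → ρ * ∑∉ (d ∷ L) (t d))        ≡⟨ ∑∉-cong L (λ d _ → ∑∉-* (d ∷ L) ρ (t d)) ⟨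
        ∑∉ L (λ d → ∑∉ (d ∷ L) λ e → ρ * t d e)  ≡⟨ ∑∉-cong L (λ d _ → ∑∉-cong (d ∷ L) λ e _ → factor d e) ⟨
        ∑∉ L (λ d → ∑∉ (d ∷ L) (tri d))          ∎
        where
        L = c ∷ b ∷ a ∷ []
        ρ = rainbowWeight (colour a b) (colour a c) (colour b c)
        E : Colour → Fin n → ℤ
        E k v = excess₃ (colour a v) (colour b v) (colour c v) k
        t : Fin n → Fin n → ℤ
        t v w = sum λ k → E k v * E k w
        tri : Fin n → Fin n → ℤ
        tri d e = tri₅ (a ∷ b ∷ c ∷ d ∷ e ∷ [])
        factor : ∀ d e → tri d e ≡ ρ * t d e
        factor d e = triTerm-factor (colour a b) (colour a c) (colour b c)
          (colour a d) (colour b d) (colour c d) (colour a e) (colour b e) (colour c e)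
        pull : ∀ x y → - (x * y) ≡ - x * y
        pull = solve-∀
        push : ∀ x y → - x * y ≡ x * - y
        push = solve-∀

    -- Bounds on the weighted sum in a counterexample

    module Counterexample (H : ∀ c a b d e → 1ℤ ≤ sum λ v → excess (hits c a b d e v)) where

      -- `H` bounds the sum over all vertices. Each of the four vertices contributes the excess
      -- given by its three edges within the quadruple, since it does not hit itself.
      linkExcess : ∀ {a b c d} → Fresh (a ∷ []) b → Fresh (b ∷ a ∷ []) c → Fresh (c ∷ b ∷ a ∷ []) d → ∀ k →
        1ℤ - inner (colour a b) (colour a c) (colour a d) (colour b c) (colour b d) (colour c d) k
          ≤ ∑∉ (d ∷ c ∷ b ∷ a ∷ []) λ e → excess₄ (colour a e) (colour b e) (colour c e) (colour d e) k
      linkExcess {a} {b} {c} {d} fb@(a≢b ∷ []) fc@(b≢c ∷ a≢c ∷ []) fd@(c≢d ∷ b≢d ∷ a≢d ∷ []) k = begin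
        1ℤ - I                                         ≤⟨ ℤ.+-monoˡ-≤ (- I) (H k a b c d) ⟩
        sum G - I                                      ≡⟨ cong (_- I) total ⟨
        X + G d + G c + G b + G a - I                  ≡⟨ cong (_- I) (cong₂ _+_ (cong₂ _+_ (cong₂ _+_ (cong (λ s → X + s) Gd) Gc) Gb) Ga) ⟩
        X + gd + gc + gb + ga - (ga + (gb + (gc + gd))) ≡⟨ cancel X ga gb gc gd ⟩
        X                                              ≡⟨ ∑∉-cong (d ∷ c ∷ b ∷ a ∷ []) outside ⟩
        ∑∉ (d ∷ c ∷ b ∷ a ∷ []) (λ e → excess₄ (colour a e) (colour b e) (colour c e) (colour d e) k) ∎
        where
        open ℤ.≤-Reasoning
        G : Fin n → ℤ
        G v = excess (hits k a b c d v)
        X = ∑∉ (d ∷ c ∷ b ∷ a ∷ []) G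
        I = inner (colour a b) (colour a c) (colour a d) (colour b c) (colour b d) (colour c d) k
        ga = excess₃ (colour a b) (colour a c) (colour a d) k
        gb = excess₃ (colour a b) (colour b c) (colour b d) k
        gc = excess₃ (colour a c) (colour b c) (colour c d) k
        gd = excess₃ (colour a d) (colour b d) (colour c d) k

        cancel : ∀ x a b c d → x + d + c + b + a - (a + (b + (c + d))) ≡ x
        cancel = solve-∀

        back : ∀ {x y} → x ≢ y → hit k y x ≡ (k == colour x y)
        back {x} {y} x≢y = trans (hit-sym k y x) (hit-≢ k x≢y)

        Ga : G a ≡ ga
        Ga rewrite hit-irrefl k a | back a≢b | back a≢c | back a≢d = refl
        Gb : G b ≡ gb
        Gb rewrite hit-irrefl k b | hit-≢ k a≢b | back b≢c | back b≢d = refl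
        Gc : G c ≡ gc
        Gc rewrite hit-irrefl k c | hit-≢ k a≢c | hit-≢ k b≢c | back c≢d = refl
        Gd : G d ≡ gd
        Gd rewrite hit-irrefl k d | hit-≢ k a≢d | hit-≢ k b≢d | hit-≢ k c≢d
          | Bool.∨-identityʳ (k == colour c d) = refl

        total : X + G d + G c + G b + G a ≡ sum G
        total = trans (cong (λ s → s + G c + G b + G a) (∑∉-∷ fd G))
               (trans (cong (λ s → s + G b + G a) (∑∉-∷ fc G))
               (trans (cong (_+ G a) (∑∉-∷ fb G))
               (trans (∑∉-∷ [] G) (∑∉-[] G))))

        outside : ∀ v → Fresh (d ∷ c ∷ b ∷ a ∷ []) v →
          G v ≡ excess₄ (colour a v) (colour b v) (colour c v) (colour d v) k
        outside v (d≢v ∷ c≢v ∷ b≢v ∷ a≢v ∷ [])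
          rewrite hit-≢ k a≢v | hit-≢ k b≢v | hit-≢ k c≢v | hit-≢ k d≢v = refl

      -- The weights are natural numbers, so `linkExcess` can be scaled by them and added over the
      -- colours.
      S-quad₅ : S 4 [] (onK₄ quadBound) ≤ S 5 [] quad₅
      S-quad₅ = ∑∉-mono [] λ a _ → ∑∉-mono (a ∷ []) λ b fb → ∑∉-mono (b ∷ a ∷ []) λ c fc →
        ∑∉-mono (c ∷ b ∷ a ∷ []) λ d fd → bound fb fc fd
        where
        open ℤ.≤-Reasoning
        bound : ∀ {a b c d} → Fresh (a ∷ []) b → Fresh (b ∷ a ∷ []) c → Fresh (c ∷ b ∷ a ∷ []) d →
          onK₄ quadBound (a ∷ b ∷ c ∷ d ∷ []) ≤ ∑∉ (d ∷ c ∷ b ∷ a ∷ []) λ e → quad₅ (a ∷ b ∷ c ∷ d ∷ e ∷ [])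
        bound {a} {b} {c} {d} fb fc fd = begin
          onK₄ quadBound (a ∷ b ∷ c ∷ d ∷ [])   ≤⟨ ∑-mono (λ k → ℤ.*-monoˡ-≤-nonNeg (+ w k) (linkExcess fb fc fd k)) ⟩
          sum (λ k → + w k * ∑∉ L (links k))    ≡⟨ ∑∉-linear L (λ k → + w k) links ⟨
          ∑∉ L (λ e → quad₅ (a ∷ b ∷ c ∷ d ∷ e ∷ [])) ∎
          where
          L = d ∷ c ∷ b ∷ a ∷ []
          shapeOf : Colour → Shape
          shapeOf k = classShape k (colour a b) (colour a c) (colour a d) (colour b c) (colour b d) (colour c d)
          w : Colour → ℕ
          w = colourWeight (shapeOf 0F) (shapeOf 1F) (shapeOf 2F)
          links : Colour → Fin n → ℤ
          links k e = excess₄ (colour a e) (colour b e) (colour c e) (colour d e) k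

      bound₄≤term₅ : S 4 [] (onK₄ bound₄) ≤ S 5 [] (onK₅ term₅)
      bound₄≤term₅ = begin
        S 4 [] (onK₄ bound₄)
          ≡⟨ split ⟩
        S 4 [] (onK₄ quadBound) + (S 4 [] tri₄ + S 4 [] tri₄)
          ≤⟨ ℤ.+-mono-≤ S-quad₅ (ℤ.+-mono-≤ S-tri₅ S-tri₅) ⟩
        S 5 [] quad₅ + (S 5 [] tri₅ + S 5 [] tri₅)
          ≡⟨ S-term₅ ⟨
        S 5 [] (onK₅ term₅) ∎
        where
        open ℤ.≤-Reasoning
        pointwise : ∀ xs → onK₄ bound₄ xs ≡ onK₄ quadBound xs + (tri₄ xs + tri₄ xs)
        pointwise (a ∷ b ∷ c ∷ d ∷ []) = refl
        split : S 4 [] (onK₄ bound₄) ≡ S 4 [] (onK₄ quadBound) + (S 4 [] tri₄ + S 4 [] tri₄)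
        split = trans
          (S-cong 4 [] pointwise)
          (trans (S-+ 4 [] (onK₄ quadBound) (λ xs → tri₄ xs + tri₄ xs))
                 (cong (λ s → S 4 [] (onK₄ quadBound) + s) (S-+ 4 [] tri₄ tri₄)))
      rotations₅-orbit : ∀ xs → orbit 4 (onK₅ term₅) xs ≡ onK₅ rotations₅ xs
      rotations₅-orbit (a ∷ b ∷ c ∷ d ∷ e ∷ [])
        rewrite colour-sym b a | colour-sym c a | colour-sym d a | colour-sym e a | colour-sym c b
          | colour-sym d b | colour-sym e b | colour-sym d c | colour-sym e c | colour-sym e d = refl

      rotations₄-orbit : ∀ xs → orbit 3 (onK₄ bound₄) xs ≡ onK₄ rotations₄ xs
      rotations₄-orbit (a ∷ b ∷ c ∷ d ∷ [])
        rewrite colour-sym b a | colour-sym c a | colour-sym d a | colour-sym c b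
          | colour-sym d b | colour-sym d c = refl

      star₄ : Vec (Fin n) 4 → ℤ
      star₄ (a ∷ b ∷ c ∷ d ∷ []) = rainbowStar (colour a b) (colour a c) (colour a d)

      -- If this sum were positive, `four` would make the sum of `bound₄` positive and hence that of
      -- `term₅`, against `five`.
      S-star₄≤0 : S 4 [] star₄ ≤ 0ℤ
      S-star₄≤0 = ℤ.≮⇒≥ λ 0<star₄ → contradiction
        (ℤ.<-≤-trans (ℤ.*-monoˡ-<-pos (+ 5) (ℤ.<-≤-trans (b>0 0<star₄) bound₄≤term₅)) five)
        (ℤ.<-irrefl refl)
        where
        five : + 5 * S 5 [] (onK₅ term₅) ≤ 0ℤ
        five = subst₂ _≤_ (S-orbit 4 [] (onK₅ term₅)) (S-zero {n} 5 []) (S-mono 5 [] pointwise)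
          where
          pointwise : ∀ xs → orbit 4 (onK₅ term₅) xs ≤ 0ℤ
          pointwise xs@(a ∷ b ∷ c ∷ d ∷ e ∷ []) = subst (_≤ 0ℤ) (sym (rotations₅-orbit xs))
            (rotations₅≤0 (colour a b) (colour a c) (colour a d) (colour a e) (colour b c)
                          (colour b d) (colour b e) (colour c d) (colour c e) (colour d e))

        four : S 4 [] star₄ ≤ + 4 * S 4 [] (onK₄ bound₄)
        four = subst (S 4 [] star₄ ≤_) (S-orbit 3 [] (onK₄ bound₄)) (S-mono 4 [] pointwise)
          where
          pointwise : ∀ xs → star₄ xs ≤ orbit 3 (onK₄ bound₄) xs
          pointwise xs@(a ∷ b ∷ c ∷ d ∷ []) = subst (star₄ xs ≤_) (sym (rotations₄-orbit xs))
            (rotations₄≥star (colour a b) (colour a c) (colour a d) (colour b c) (colour b d) (colour c d))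

        b>0 : 0ℤ < S 4 [] star₄ → 0ℤ < S 4 [] (onK₄ bound₄)
        b>0 0<star₄ = ℤ.*-cancelˡ-<-nonNeg (+ 4) (ℤ.<-≤-trans 0<star₄ four)

      -- Every vertex misses a colour

      noRainbowStar : ∀ {v x y z} → v ≢ x → v ≢ y → v ≢ z →
        colour v x ≡ 0F → colour v y ≡ 1F → colour v z ≡ 2F → ⊥
      noRainbowStar {v} {x} {y} {z} v≢x v≢y v≢z vx vy vz = contradiction (ℤ.≤-trans 1≤S S-star₄≤0) λ { (+≤+ ()) }
        where
        differ : ∀ {x y c d} → colour v x ≡ c → colour v y ≡ d → c ≢ d → x ≢ y
        differ vx vy c≢d refl = c≢d (trans (sym vx) vy)

        isOne : star₄ (v ∷ x ∷ y ∷ z ∷ []) ≡ 1ℤ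
        isOne rewrite vx | vy | vz = refl

        star₄≥0 : ∀ xs → 0ℤ ≤ star₄ xs
        star₄≥0 (a ∷ b ∷ c ∷ d ∷ []) = rainbowStar-nonNeg (colour a b) (colour a c) (colour a d)

        1≤S : 1ℤ ≤ S 4 [] star₄
        -- The leaves are distinct because their edges to `v` have distinct colours.
        1≤S = subst (_≤ S 4 [] star₄) isOne (term≤S star₄≥0
          ( [] , (v≢x ∷ []) , (differ vx vy (λ ()) ∷ v≢y ∷ [])
          , (differ vy vz (λ ()) ∷ differ vx vz (λ ()) ∷ v≢z ∷ []) , tt))

      missingColour : ∀ v → ∃[ c ] ∀ y → hit c v y ≡ false
      missingColour v with any? (seen 0F) | any? (seen 1F) | any? (seen 2F)
        where
        seen : ∀ c y → Dec (hit c v y ≡ true)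
        seen c y = hit c v y Bool.≟ true
      ... | no ∄x | _ | _ = 0F , λ y → Bool.¬-not (∄x ∘ (y ,_))
      ... | _ | no ∄y | _ = 1F , λ y → Bool.¬-not (∄y ∘ (y ,_))
      ... | _ | _ | no ∄z = 2F , λ y → Bool.¬-not (∄z ∘ (y ,_))
      ... | yes (x , vx) | yes (y , vy) | yes (z , vz) =
        let v≢x , x-col = hit⇒Joined 0F v x vx
            v≢y , y-col = hit⇒Joined 1F v y vy
            v≢z , z-col = hit⇒Joined 2F v z vz
        in ⊥-elim (noRainbowStar v≢x v≢y v≢z x-col y-col z-col)

      -- All vertices miss the same colour

      missing : Fin n → Colour
      missing v = proj₁ (missingColour v)

      missing-≢ : ∀ {v y} → v ≢ y → missing v ≢ colour v y
      missing-≢ {v} {y} v≢y eq = case trans (sym (proj₂ (missingColour v) y)) (trans (hit-≢ (missing v) v≢y) same) of λ ()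
        where
        same : (missing v == colour v y) ≡ true
        same = trans (cong (_== colour v y) eq) (==-refl (colour v y))

      -- The edge `xv` avoids the colours missing at both ends, which leaves only `c`.
      hit-third : ∀ {x v c} → missing x ≢ missing v → missing x ≢ c → missing v ≢ c → hit c x v ≡ true
      hit-third {x} {v} {c} mx≢mv mx≢c mv≢c = trans (hit-≢ c x≢v)
        (third-unique mx≢mv mx≢c mv≢c (missing-≢ x≢v) λ eq → missing-≢ (≢-sym x≢v) (trans eq (colour-sym x v)))
        where
        x≢v : x ≢ v
        x≢v = mx≢mv ∘ cong missing

      -- If `v` does not have `c` as its missing colour, its missing colour differs from that of `x`
      -- or that of `y`, and `hit-third` applies to that vertex. So the vertices not hit by `x` and
      -- `y` all have missing colour `c`.
      manyMissing : ∀ {x y c} → missing x ≢ missing y → missing x ≢ c → missing y ≢ c →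
        1ℤ ≤ sum λ v → excess (not (missing v == c))
      manyMissing {x} {y} {c} mx≢my mx≢c my≢c = ℤ.≤-trans (H c x y y y) (∑-mono pointwise)
        where
        excess≤2 : ∀ h → excess h ≤ + 2
        excess≤2 true  = -≤+
        excess≤2 false = ℤ.≤-refl

        pointwise : ∀ v → excess (hits c x y y y v) ≤ excess (not (missing v == c))
        pointwise v with missing v ≟ c
        ... | yes refl rewrite ==-refl (missing v) = excess≤2 _
        ... | no mv≢c rewrite ≢⇒== mv≢c with missing x ≟ missing v
        ...   | no mx≢mv rewrite hit-third mx≢mv mx≢c mv≢c = ℤ.≤-refl
        ...   | yes mx≡mv rewrite hit-third {y} {v} (λ eq → mx≢my (trans mx≡mv (sym eq))) my≢c mv≢c
                | Bool.∨-zeroʳ (hit c x v) = ℤ.≤-refl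

      missing-constant : ∀ x y → missing x ≡ missing y
      missing-constant x y with missing x ≟ missing y
      ... | yes eq = eq
      ... | no mx≢my = contradiction (ℤ.≤-trans three (ℤ.≤-reflexive total)) λ { (+≤+ ()) }
        where
        c = proj₁ (thirdColour mx≢my)
        mx≢c = proj₁ (proj₂ (thirdColour mx≢my))
        my≢c = proj₂ (proj₂ (thirdColour mx≢my))

        -- A positive total gives a vertex `z` with missing colour `c`; now `x`, `y`, `z` represent
        -- all three colours.
        witness = ∃-unhit _ (manyMissing mx≢my mx≢c my≢c)
        z = proj₁ witness
        mz≡c : missing z ≡ c
        mz≡c = ==⇒≡ _ _ (Bool.not-injective (proj₂ witness))

        -- For each `d`, `manyMissing` applies to the two of `x`, `y`, `z` whose missing colours
        -- differ from `d`.
        many : ∀ d → 1ℤ ≤ sum λ v → excess (not (missing v == d))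
        many d with missing x ≟ d | missing y ≟ d
        ... | no mx≢d  | no my≢d  = manyMissing mx≢my mx≢d my≢d
        ... | yes refl | _        = manyMissing {y} {z} (λ eq → my≢c (trans eq mz≡c)) (≢-sym mx≢my) (λ eq → mx≢c (trans (sym eq) mz≡c))
        ... | no mx≢d  | yes refl = manyMissing {x} {z} (λ eq → mx≢c (trans eq mz≡c)) mx≢my (λ eq → my≢c (trans (sym eq) mz≡c))

        M : Colour → Fin n → ℤ
        M d v = excess (not (missing v == d))

        three : + 3 ≤ sum (M 0F) + (sum (M 1F) + sum (M 2F))
        three = ℤ.+-mono-≤ (many 0F) (ℤ.+-mono-≤ (many 1F) (many 2F))

        -- Each vertex counts 2 for its own missing colour and -1 for each of the two others.
        cancel : ∀ k → excess (not (k == 0F)) + (excess (not (k == 1F)) + excess (not (k == 2F))) ≡ 0ℤ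
        cancel 0F = refl
        cancel 1F = refl
        cancel 2F = refl

        total : sum (M 0F) + (sum (M 1F) + sum (M 2F)) ≡ 0ℤ
        total = trans (cong (λ s → sum (M 0F) + s) (sym (∑-distrib-+ (M 1F) (M 2F))))
               (trans (sym (∑-distrib-+ (M 0F) (λ v → M 1F v + M 2F v)))
               (trans (sum-cong-≗ λ v → cancel (missing v)) (sum-replicate-zero n)))

      -- The case of two colours

      manyUnhit : ∀ c a b d e (P : Fin n → Bool) → (∀ v → P v ≡ false → hits c a b d e v ≡ true) →
        1ℤ + + n ≤ + 3 * sum (indicator ∘ P)
      manyUnhit c a b d e P covered = begin
        1ℤ + + n                                    ≤⟨ ℤ.+-monoˡ-≤ (+ n) (H c a b d e) ⟩
        sum G + + n                                 ≡⟨ cong (λ s → sum G + s) (∑-one n) ⟨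
        sum G + sum {n} (λ _ → 1ℤ)                  ≡⟨ ∑-distrib-+ G (λ _ → 1ℤ) ⟨
        sum (λ v → G v + 1ℤ)                        ≤⟨ ∑-mono pointwise ⟩
        sum (λ v → + 3 * indicator (P v))           ≡⟨ *-distribˡ-sum (+ 3) (indicator ∘ P) ⟨
        + 3 * sum (indicator ∘ P)                   ∎
        where
        open ℤ.≤-Reasoning
        G : Fin n → ℤ
        G v = excess (hits c a b d e v)
        at-most-3 : ∀ h → excess h + 1ℤ ≤ + 3
        at-most-3 true  = +≤+ z≤n
        at-most-3 false = ℤ.≤-refl
        -- Excess plus one is 3 at a vertex that is not hit and 0 at a hit one, and `P` contains all
        -- vertices that are not hit.
        pointwise : ∀ v → G v + 1ℤ ≤ + 3 * indicator (P v)
        pointwise v with P v in eq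
        ... | true  = at-most-3 (hits c a b d e v)
        ... | false rewrite covered v eq = ℤ.≤-refl

      noTwoColouring : ∀ {k} → (∀ v → missing v ≡ k) → ∀ {x y} → x ≢ y → ⊥
      noTwoColouring {k} missing≡k {x} {y} x≢y = productTooSmall D>0 (∑-nonNeg λ v → indicator-nonNeg (E v)) D+E<m
        (doubleCount (1ℤ + + n) D E R rowBound columnBound)
        where
        edge≢k : ∀ {u v} → u ≢ v → k ≢ colour u v
        edge≢k {u} u≢v eq = missing-≢ u≢v (trans (missing≡k u) eq)

        red = colour x y
        blue = proj₁ (thirdColour (edge≢k x≢y))
        k≢blue = proj₁ (proj₂ (thirdColour (edge≢k x≢y)))
        red≢blue = proj₂ (proj₂ (thirdColour (edge≢k x≢y)))

        R : Fin n → Fin n → Bool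
        R = hit red

        -- Since `xy` is red, neither `x` nor `y` lies in `D`; since no vertex hits itself, neither
        -- lies in `E`.
        D E : Fin n → Bool
        D v = not (R x v ∨ R y v)
        E v = R x v ∧ R y v

        notRed⇒blue : ∀ {u v} → u ≢ v → R u v ≡ false → hit blue u v ≡ true
        notRed⇒blue {u} {v} u≢v notRed = trans (hit-≢ blue u≢v)
          (third-unique (edge≢k x≢y) k≢blue red≢blue (edge≢k u≢v) λ eq →
            case trans (sym notRed) (trans (hit-≢ red u≢v) (trans (cong (red ==_) (sym eq)) (==-refl red))) of λ ())

        D>0 : 0ℤ < sum (indicator ∘ D)
        D>0 = ℤ.*-cancelˡ-<-nonNeg (+ 3) (ℤ.<-≤-trans (+<+ (s≤s z≤n)) (manyUnhit red x y y y D covered))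
          where
          covered : ∀ v → D v ≡ false → hits red x y y y v ≡ true
          covered v eq with R x v | R y v
          ... | true  | _    = refl
          ... | false | true = refl

        D+E<m : sum (indicator ∘ D) + sum (indicator ∘ E) < 1ℤ + + n
        D+E<m = ℤ.≤-<-trans
          (subst₂ _≤_ (∑-distrib-+ (indicator ∘ D) (indicator ∘ E)) (∑-one n) (∑-mono disjoint)) (+<+ (ℕ.n<1+n n))
          where
          disjoint : ∀ v → indicator (D v) + indicator (E v) ≤ 1ℤ
          disjoint v with R x v | R y v
          ... | true  | true  = ℤ.≤-refl
          ... | true  | false = +≤+ z≤n
          ... | false | true  = +≤+ z≤n
          ... | false | false = ℤ.≤-refl

        columnBound : ∀ e → E e ≡ true → 1ℤ + + n ≤ + 3 * sum λ d → indicator (D d ∧ not (R d e))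
        -- A vertex that the red set `{x, y, e}` does not hit lies in `D` and is not joined to `e`
        -- in red.
        columnBound e _ = manyUnhit red x y e e (λ d → D d ∧ not (R d e)) covered
          where
          covered : ∀ v → (D v ∧ not (R v e)) ≡ false → hits red x y e e v ≡ true
          covered v eq rewrite hit-sym red v e with R x v | R y v | R e v
          ... | true  | _     | _    = refl
          ... | false | true  | _    = refl
          ... | false | false | true = refl

        rowBound : ∀ d → D d ≡ true → 1ℤ + + n ≤ + 3 * sum λ e → indicator (E e ∧ R d e)
        -- A vertex that the blue set `{x, y, d}` does not hit is joined in red to all three. The
        -- three vertices themselves are hit: `x` and `y` by `d`, and `d` by `x`.
        rowBound d Dd = manyUnhit blue x y d d (λ e → E e ∧ R d e) covered
          where
          Rxd : R x d ≡ false
          Rxd = Bool.∨-conicalˡ (R x d) (R y d) (Bool.not-injective Dd)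
          Ryd : R y d ≡ false
          Ryd = Bool.∨-conicalʳ (R x d) (R y d) (Bool.not-injective Dd)
          Rxy : R x y ≡ true
          Rxy = trans (hit-≢ red x≢y) (==-refl red)
          x≢d : x ≢ d
          x≢d refl = case trans (sym Ryd) (trans (hit-sym red y x) Rxy) of λ ()
          y≢d : y ≢ d
          y≢d refl = case trans (sym Rxd) Rxy of λ ()

          blueTo : ∀ {u} → u ≢ d → R u d ≡ false → hit blue d u ≡ true
          blueTo {u} u≢d notRed = trans (hit-sym blue d u) (notRed⇒blue u≢d notRed)

          covered : ∀ v → (E v ∧ R d v) ≡ false → hits blue x y d d v ≡ true
          covered v = cases (x ≟ v) (y ≟ v) (d ≟ v)
            where
            first : ∀ {p} q r → p ≡ true → (p ∨ q ∨ r ∨ r) ≡ true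
            first q r refl = refl
            third : ∀ p q {r} → r ≡ true → (p ∨ q ∨ r ∨ r) ≡ true
            third p q refl = trans (cong (p ∨_) (Bool.∨-zeroʳ q)) (Bool.∨-zeroʳ p)
            byRed : ∀ p q r {p′ q′ r′ : Bool} → ((p ∧ q) ∧ r) ≡ false → (p ≡ false → p′ ≡ true) →
              (q ≡ false → q′ ≡ true) → (r ≡ false → r′ ≡ true) → (p′ ∨ q′ ∨ r′ ∨ r′) ≡ true
            byRed false _     _     {_} {q′} {r′} _ f _ _ = first q′ r′ (f refl)
            byRed true  false _     {p′} _ _ g _ rewrite g refl = Bool.∨-zeroʳ p′
            byRed true  true  false {p′} {q′} _ _ _ h = third p′ q′ (h refl)

            cases : Dec (x ≡ v) → Dec (y ≡ v) → Dec (d ≡ v) → (E v ∧ R d v) ≡ false → hits blue x y d d v ≡ true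
            cases (yes refl) _ _ _ = third (hit blue x v) (hit blue y v) (blueTo x≢d Rxd)
            cases (no _) (yes refl) _ _ = third (hit blue x v) (hit blue y v) (blueTo y≢d Ryd)
            cases (no _) (no _) (yes refl) _ = first (hit blue y v) (hit blue d v) (notRed⇒blue x≢d Rxd)
            cases (no x≢v) (no y≢v) (no d≢v) eq =
              byRed (R x v) (R y v) (R d v) eq (notRed⇒blue x≢v) (notRed⇒blue y≢v) (notRed⇒blue d≢v)

    -- The dominating sets

    quadruple : (a b d e : Fin n) → Subset n
    quadruple a b d e = ⁅ a ⁆ ∪ (⁅ b ⁆ ∪ (⁅ d ⁆ ∪ ⁅ e ⁆))

    ∣quadruple∣≤4 : ∀ a b d e → ∣ quadruple a b d e ∣ ℕ.≤ 4
    ∣quadruple∣≤4 a b d e = add a _ (add b _ (add d _ (ℕ.≤-reflexive (∣⁅x⁆∣≡1 e))))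
      where
      add : ∀ x (p : Subset n) {k} → ∣ p ∣ ℕ.≤ k → ∣ ⁅ x ⁆ ∪ p ∣ ℕ.≤ suc k
      add x p le = ℕ.≤-trans (∣p∪q∣≤∣p∣+∣q∣ ⁅ x ⁆ p) (ℕ.+-mono-≤ (ℕ.≤-reflexive (∣⁅x⁆∣≡1 x)) le)

    dominated : Colour → (a b d e : Fin n) → Subset n
    dominated c a b d e = tabulate (hits c a b d e)

    dominates : ∀ c a b d e → StronglyDominates χ c (quadruple a b d e) (dominated c a b d e)
    dominates c a b d e = (λ y y∈B _ → joined y y∈B) , (λ y y∈B _ → joined y y∈B)
      where
      joined : ∀ y → y ∈ dominated c a b d e → ∃[ x ] x ∈ quadruple a b d e × Joined χ c x y
      joined y y∈B with hit c a y in ha | hit c b y in hb | hit c d y in hd | hit c e y in he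
        | trans (sym (lookup∘tabulate (hits c a b d e) y)) ([]=⇒lookup y∈B)
      ... | true  | _ | _ | _ | _ = a , x∈p∪q⁺ (inj₁ (x∈⁅x⁆ a)) , hit⇒Joined c a y ha
      ... | false | true | _ | _ | _ = b , x∈p∪q⁺ (inj₂ (x∈p∪q⁺ (inj₁ (x∈⁅x⁆ b)))) , hit⇒Joined c b y hb
      ... | false | false | true | _ | _ =
        d , x∈p∪q⁺ (inj₂ (x∈p∪q⁺ (inj₂ (x∈p∪q⁺ (inj₁ (x∈⁅x⁆ d)))))) , hit⇒Joined c d y hd
      ... | false | false | false | true | _ =
        e , x∈p∪q⁺ (inj₂ (x∈p∪q⁺ (inj₂ (x∈p∪q⁺ (inj₂ (x∈⁅x⁆ e)))))) , hit⇒Joined c e y he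

    noCounterexample : 2 ℕ.≤ n → ¬ (∀ c a b d e → 1ℤ ≤ sum λ v → excess (hits c a b d e v))
    noCounterexample (s≤s (s≤s z≤n)) H =
      -- As `n` is at least 2, there is an edge to serve as the red edge.
      noTwoColouring (λ v → missing-constant v zero) {zero} {suc zero} λ ()
      where open Counterexample H

    -- A finite search over colours and quadruples is decidable, so refuting its failure yields a
    -- witness.
    manyDominated : 2 ℕ.≤ n → ∃[ c ] ∃[ a ] ∃[ b ] ∃[ d ] ∃[ e ] 2 ℕ.* n ℕ.≤ 3 ℕ.* ∣ dominated c a b d e ∣
    manyDominated 2≤n with any? (λ c → any? λ a → any? λ b → any? λ d → any? λ e →
      2 ℕ.* n ℕ.≤? 3 ℕ.* ∣ dominated c a b d e ∣)
    ... | yes found = found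
    ... | no none   = contradiction
      (λ c a b d e → fewHit (hits c a b d e) λ large → none (c , a , b , d , e , large))
      (noCounterexample 2≤n)

open import Data.Nat.Base using (_≤_; _*_)
open import Data.Product.Base using (_,_)
open Development using (module Counting)

theorem2 : (n : ℕ) → 2 ≤ n → (χ : EdgeColouring 3 n) →
    Σ[ c ∈ Fin 3 ] Σ[ A ∈ Subset n ] Σ[ B ∈ Subset n ]
    (∣ A ∣ ≤ 4 × StronglyDominates χ c A B × 2 * n ≤ 3 * ∣ B ∣)
theorem2 n 2≤n χ =
  let open Counting χ
      c , a , b , d , e , large = manyDominated 2≤n
  in c , quadruple a b d e , dominated c a b d e , ∣quadruple∣≤4 a b d e , dominates c a b d e , large
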